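{- Let $k$ be a positive integer and let $H$ be an $n$-vertex directed graph that is $k$-critical. Then $|E(H)|=O(k^{1/2}n^{3/2})$.
   Context: For a directed graph $G$, $\mathrm{flow}(G,s,t)$ is the maximum number of pairwise edge-disjoint $s$-to-$t$ paths, $\lambda_G(s,t)=\min(\mathrm{flow}(G,s,t),\mathrm{flow}(G,t,s))$ and $\lambda^k_G(s,t)=\min(\lambda_G(s,t),k)$. A subgraph $H'$ of $H$ (same vertex set, subset of edges) is a $k$-connectivity preserver of $H$ if $\lambda^k_{H'}(s,t)=\lambda^k_H(s,t)$ for all $s,t\in V(H)$. A graph $H$ is $k$-critical if no subgraph $H'$ of $H$ with $E(H')\subsetneq E(H)$ is a $k$-connectivity preserver of $H$. -}

module Defs where

open import Data.Nat using (ℕ; zero; suc; _+_; _*_; _^_; _≤_)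
open import Data.Fin using (Fin)
open import Data.Bool using (Bool; true; false; if_then_else_)
open import Data.List using (List; []; _∷_; map; allFin; concatMap)
open import Data.Nat.ListAction using (sum)
open import Data.List.Membership.Propositional using (_∈_)
open import Data.List.Relation.Unary.Unique.Propositional using (Unique)
open import Data.Product using (Σ; _×_; _,_; proj₁; ∃)
open import Relation.Binary.PropositionalEquality using (_≡_; _≢_)
open import Relation.Nullary using (¬_)
open import Data.Empty using (⊥)
open import Function.Bundles using (_⇔_)

Graph : ℕ → Set
Graph n = Fin n → Fin n → Bool

numEdges : ∀ {n} → Graph n → ℕ
numEdges {n} G =
  sum (concatMap (λ u → map (λ v → if G u v then 1 else 0) (allFin n)) (allFin n))

data Walk {n} (G : Graph n) : Fin n → Fin n → Set where
  [] : ∀ {s} → Walk G s s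
  _∷_ : ∀ {s u t} → G s u ≡ true → Walk G u t → Walk G s t

vertices : ∀ {n} {G : Graph n} {s t} → Walk G s t → List (Fin n)
vertices {s = s} [] = s ∷ []
vertices {s = s} (_ ∷ w) = s ∷ vertices w

edges : ∀ {n} {G : Graph n} {s t} → Walk G s t → List (Fin n × Fin n)
edges [] = []
edges {s = s} (_∷_ {u = u} _ w) = (s , u) ∷ edges w

Path : ∀ {n} → Graph n → Fin n → Fin n → Set
Path G s t = Σ (Walk G s t) (λ w → Unique (vertices w))

EdgeDisjoint : ∀ {n} {G : Graph n} {s t} → Path G s t → Path G s t → Set
EdgeDisjoint p q = ∀ e → e ∈ edges (proj₁ p) → e ∈ edges (proj₁ q) → ⊥

FlowAtLeast : ∀ {n} → Graph n → Fin n → Fin n → ℕ → Set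
FlowAtLeast G s t m =
  Σ (Fin m → Path G s t) (λ P → ∀ i j → i ≢ j → EdgeDisjoint (P i) (P j))

-- λ^k_G(s,t) ≥ j, where λ^k_G(s,t) = min(flow(G,s,t), flow(G,t,s), k).
LamKAtLeast : ∀ {n} → Graph n → ℕ → Fin n → Fin n → ℕ → Set
LamKAtLeast G k s t j = j ≤ k × FlowAtLeast G s t j × FlowAtLeast G t s j

_⊆G_ : ∀ {n} → Graph n → Graph n → Set
H' ⊆G H = ∀ u v → H' u v ≡ true → H u v ≡ true

-- H' is a k-connectivity preserver of H: λ^k_{H'}(s,t) = λ^k_H(s,t) for all s,t
-- (two naturals are equal iff they have the same lower thresholds j).
IsPreserver : ∀ {n} → ℕ → Graph n → Graph n → Set
IsPreserver k H H' =
  H' ⊆G H × (∀ s t j → LamKAtLeast H' k s t j ⇔ LamKAtLeast H k s t j)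

IsCritical : ∀ {n} → ℕ → Graph n → Set
IsCritical k H =
  ∀ H' → H' ⊆G H → (∃ λ u → ∃ λ v → H u v ≡ true × H' u v ≡ false) →
  ¬ IsPreserver k H H'

{-# OPTIONS --safe #-}
module Submission where

-- Write out X and inn X for the numbers of edges leaving and entering a vertex set X.
--
-- (1) By Menger's theorem every edge (u , v) of a k-critical H leaves some X with u ∈ X, v ∉ X and out X ≤ k;
--     otherwise deleting (u , v) would leave all λ^k unchanged.
-- (2) λ^k is an ultrametric, so it is preserved by the flows, in both directions, along the at most n - 1 edges
--     of a maximum spanning tree, and H is the union of these flows. A flow of value at most k enters X at most
--     out X + k times, so out X ≤ k implies inn X ≤ K with K = 4kn.
-- (3) Let ℓ² ≥ k + K. For a set P of tails and a set Q of heads, discard vertices with fewer than 2ℓ edges between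
--     P and Q. When none is left, take an edge and X as in (1). If |P ∩ X| < ℓ then X contains at least ℓ heads in Q
--     and each of them has more than ℓ tails in P ∖ X, which makes inn X > K; so |P ∩ X| ≥ ℓ and dually |Q ∖ X| ≥ ℓ.
--     Hence splitting along X loses at most k + K edges and happens at most 2n/ℓ times, and
--     |E(H)| = O(ℓ n) = O(k^{1/2} n^{3/2}).

open import Defs
open import Data.Bool using (Bool; true; false; if_then_else_; _∧_; _∨_; not)
import Data.Bool.Properties as Bool
open import Data.Empty using (⊥; ⊥-elim)
open import Data.Fin using (Fin; zero; suc; toℕ; _≟_)
open import Data.Fin.Properties using (any?; toℕ-injective)
open import Data.List using (List; []; map; allFin; tabulate; concatMap) renaming (_∷_ to _∷ᴸ_)
open import Data.List.Membership.Propositional using (_∈_; _∉_)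
open import Data.List.Properties using (map-tabulate)
open import Data.List.Relation.Unary.All as All using (All; [])
open import Data.List.Relation.Unary.AllPairs using ([]; _∷_)
open import Data.List.Relation.Unary.Any using (here; there)
open import Data.List.Relation.Unary.Unique.Propositional using (Unique)
open import Data.Nat using (ℕ; zero; suc; _+_; _*_; _^_; _≤_; _<_; z≤n; s≤s; s≤s⁻¹; _≤?_; _<?_; >-nonZero)
import Data.Nat.ListAction as List
open import Data.Nat.ListAction.Properties using (sum-++)
open import Data.Nat.Properties hiding (_≟_)
open import Data.Nat.Tactic.RingSolver using (solve-∀)
open import Data.Product using (Σ; Σ-syntax; ∃; _×_; _,_; proj₁; proj₂)
open import Data.Sum using (_⊎_; inj₁; inj₂)
open import Function using (_∘_; id)
open import Function.Bundles using (mk⇔)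
open import Relation.Binary.Definitions using (tri<; tri≈; tri>)
open import Relation.Binary.PropositionalEquality using (_≡_; _≢_; _≗_; refl; sym; trans; cong; cong₂; subst; module ≡-Reasoning)
open import Relation.Nullary using (¬_; Dec; does; yes; no)
open import Relation.Nullary.Decidable using (_×-dec_; dec-true)
open import Algebra.Properties.Semiring.Sum +-*-semiring using (sum; sum-cong-≗; ∑-distrib-+; ∑-comm; *-distribʳ-sum)

-- Counting edges between vertex sets

opaque
  ∑ : ∀ {n} → (Fin n → ℕ) → ℕ
  ∑ = sum

  ∑-cong : ∀ {n} {f g : Fin n → ℕ} → f ≗ g → ∑ f ≡ ∑ g
  ∑-cong = sum-cong-≗

  ∑-+ : ∀ {n} (f g : Fin n → ℕ) → ∑ (λ i → f i + g i) ≡ ∑ f + ∑ g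
  ∑-+ = ∑-distrib-+

  ∑-swap : ∀ {m n} (f : Fin m → Fin n → ℕ) → ∑ (λ i → ∑ (f i)) ≡ ∑ (λ j → ∑ (λ i → f i j))
  ∑-swap = ∑-comm

  ∑-*ʳ : ∀ {n} c (f : Fin n → ℕ) → ∑ f * c ≡ ∑ (λ i → f i * c)
  ∑-*ʳ = *-distribʳ-sum

  ∑-mono-≤ : ∀ {n} {f g : Fin n → ℕ} → (∀ i → f i ≤ g i) → ∑ f ≤ ∑ g
  ∑-mono-≤ {zero} h = z≤n
  ∑-mono-≤ {suc n} h = +-mono-≤ (h zero) (∑-mono-≤ (h ∘ suc))

  ∑-const : ∀ n c → ∑ {n} (λ _ → c) ≡ n * c
  ∑-const zero c = refl
  ∑-const (suc n) c = cong (c +_) (∑-const n c)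

  term≤∑ : ∀ {n} (f : Fin n → ℕ) i → f i ≤ ∑ f
  term≤∑ f zero = m≤m+n _ _
  term≤∑ f (suc i) = ≤-trans (term≤∑ (f ∘ suc) i) (m≤n+m _ _)

  -- The two sums without their terms at `i` coincide; the subtracted terms are moved to the other
  -- side to stay in the naturals.
  ∑-exchange : ∀ {n} (f g : Fin n → ℕ) i → (∀ j → j ≢ i → f j ≡ g j) → ∑ f + g i ≡ ∑ g + f i
  ∑-exchange f g zero h =
    trans (cong (λ x → f zero + x + g zero) (∑-cong (λ j → h (suc j) λ ()))) (swap (f zero) _ (g zero))
    where
    swap : ∀ a b c → a + b + c ≡ c + b + a
    swap = solve-∀
  ∑-exchange f g (suc i) h = begin
    f zero + ∑ (f ∘ suc) + g (suc i)    ≡⟨ +-assoc (f zero) _ _ ⟩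
    f zero + (∑ (f ∘ suc) + g (suc i))  ≡⟨ cong₂ _+_ (h zero λ ()) (∑-exchange (f ∘ suc) (g ∘ suc) i λ j j≢i → h (suc j) (j≢i ∘ λ { refl → refl })) ⟩
    g zero + (∑ (g ∘ suc) + f (suc i))  ≡⟨ +-assoc (g zero) _ _ ⟨
    g zero + ∑ (g ∘ suc) + f (suc i)    ∎
    where open ≡-Reasoning

  sum-tabulate : ∀ {n} (f : Fin n → ℕ) → List.sum (tabulate f) ≡ ∑ f
  sum-tabulate {zero} f = refl
  sum-tabulate {suc n} f = cong (f zero +_) (sum-tabulate (f ∘ suc))

⟦_⟧ : Bool → ℕ
⟦ b ⟧ = if b then 1 else 0

⟦⟧-mono : ∀ {a b} → (a ≡ true → b ≡ true) → ⟦ a ⟧ ≤ ⟦ b ⟧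
⟦⟧-mono {false} h = z≤n
⟦⟧-mono {true} h rewrite h refl = ≤-refl

⟦⟧≤1 : ∀ b → ⟦ b ⟧ ≤ 1
⟦⟧≤1 false = z≤n
⟦⟧≤1 true = ≤-refl

∧-true : ∀ {a b} → a ∧ b ≡ true → a ≡ true × b ≡ true
∧-true {true} {true} _ = refl , refl

true-∧ : ∀ {a b} → a ≡ true → b ≡ true → a ∧ b ≡ true
true-∧ refl refl = refl

not-true : ∀ {a} → not a ≡ true → a ≡ false
not-true {false} _ = refl

true≢false : ∀ {a : Bool} → a ≡ true → a ≡ false → ⊥
true≢false refl ()

VSet : ℕ → Set
VSet n = Fin n → Bool

∁ : ∀ {n} → VSet n → VSet n
∁ P i = not (P i)

_∩_ _∖_ : ∀ {n} → VSet n → VSet n → VSet n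
(P ∩ Q) i = P i ∧ Q i
P ∖ Q = P ∩ ∁ Q

infixl 7 _∩_ _∖_

opaque
  delete : ∀ {n} → Fin n → VSet n → VSet n
  delete x P i with i ≟ x
  ... | yes _ = false
  ... | no _ = P i

  delete-self : ∀ {n} (x : Fin n) P → delete x P x ≡ false
  delete-self x P with x ≟ x
  ... | yes _ = refl
  ... | no x≢x = ⊥-elim (x≢x refl)

  delete-other : ∀ {n} (x : Fin n) P {i} → i ≢ x → delete x P i ≡ P i
  delete-other x P {i} i≢x with i ≟ x
  ... | yes i≡x = ⊥-elim (i≢x i≡x)
  ... | no _ = refl

_ᵀ : ∀ {n} → Graph n → Graph n
(G ᵀ) u v = G v u

_∪_ : ∀ {n} → Graph n → Graph n → Graph n
(f ∪ g) u v = f u v ∨ g u v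

⋃ : ∀ {m n} → (Fin m → Graph n) → Graph n
⋃ F u v = does (any? (λ z → F z u v Bool.≟ true))

⊆-⋃ : ∀ {m n} (F : Fin m → Graph n) z → F z ⊆G ⋃ F
⊆-⋃ F z u v Fzuv = dec-true (any? (λ z → F z u v Bool.≟ true)) (z , Fzuv)

⋃⇒∃ : ∀ {m n} (F : Fin m → Graph n) u v → (⋃ F) u v ≡ true → ∃ λ z → F z u v ≡ true
⋃⇒∃ F u v eq with any? (λ z → F z u v Bool.≟ true)
... | yes found = found

AgreeOff : ∀ {n} → Fin n → Fin n → Graph n → Graph n → Set
AgreeOff p q f g = ∀ a b → ¬ (a ≡ p × b ≡ q) → f a b ≡ g a b

opaque
  size : ∀ {n} → VSet n → ℕ
  size P = ∑ (λ i → ⟦ P i ⟧)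

  size-mono : ∀ {n} {P Q : VSet n} → (∀ i → P i ≡ true → Q i ≡ true) → size P ≤ size Q
  size-mono h = ∑-mono-≤ (λ i → ⟦⟧-mono (h i))

  size-split : ∀ {n} (P X : VSet n) → size P ≡ size (P ∩ X) + size (P ∖ X)
  size-split P X = trans (∑-cong (λ i → pt (P i) (X i))) (∑-+ _ _)
    where
    pt : ∀ p x → ⟦ p ⟧ ≡ ⟦ p ∧ x ⟧ + ⟦ p ∧ not x ⟧
    pt false x = refl
    pt true false = refl
    pt true true = refl

  size-⊤ : ∀ n → size {n} (λ _ → true) ≡ n
  size-⊤ n = trans (∑-const n 1) (*-identityʳ n)

  size-delete : ∀ {n} (x : Fin n) P → P x ≡ true → size P ≡ suc (size (delete x P))
  size-delete x P Px = begin
    size P                                        ≡⟨ +-identityʳ _ ⟨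
    size P + 0                                    ≡⟨ cong (λ b → size P + ⟦ b ⟧) (delete-self x P) ⟨
    size P + ⟦ delete x P x ⟧                     ≡⟨ ∑-exchange _ _ x (λ j j≢x → cong ⟦_⟧ (sym (delete-other x P j≢x))) ⟩
    size (delete x P) + ⟦ P x ⟧                   ≡⟨ cong (λ b → size (delete x P) + ⟦ b ⟧) Px ⟩
    size (delete x P) + 1                         ≡⟨ +-comm _ 1 ⟩
    suc (size (delete x P))                       ∎
    where open ≡-Reasoning

  -- Out-degree into `Q`; the in-degree from `P` is written `deg (G ᵀ) P`.
  deg : ∀ {n} → Graph n → VSet n → Fin n → ℕ
  deg G Q u = size (λ v → Q v ∧ G u v)

  e : ∀ {n} → Graph n → VSet n → VSet n → ℕ
  e G P Q = ∑ (λ u → size (λ v → P u ∧ (Q v ∧ G u v)))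

  e-ᵀ : ∀ {n} (G : Graph n) P Q → e (G ᵀ) P Q ≡ e G Q P
  e-ᵀ G P Q = trans (∑-swap _) (∑-cong λ u → ∑-cong λ v → cong ⟦_⟧ (pt (P v) (Q u) (G u v)))
    where
    pt : ∀ p q g → p ∧ (q ∧ g) ≡ q ∧ (p ∧ g)
    pt false false g = refl
    pt false true g = refl
    pt true q g = refl

  e-mono : ∀ {n} {G G' : Graph n} {P P' Q Q'} →
           (∀ u v → P u ≡ true → Q v ≡ true → G u v ≡ true → P' u ≡ true × Q' v ≡ true × G' u v ≡ true) →
           e G P Q ≤ e G' P' Q'
  e-mono h = ∑-mono-≤ λ u → size-mono λ v pqg →
    let p , qg = ∧-true pqg
        q , g = ∧-true qg
        p' , q' , g' = h u v p q g
    in true-∧ p' (true-∧ q' g')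

  e-split-tails : ∀ {n} (G : Graph n) P Q X → e G P Q ≡ e G (P ∩ X) Q + e G (P ∖ X) Q
  e-split-tails G P Q X =
    trans (∑-cong λ u → trans (∑-cong λ v → pt (P u) (X u) (Q v ∧ G u v)) (∑-+ _ _)) (∑-+ _ _)
    where
    pt : ∀ p x r → ⟦ p ∧ r ⟧ ≡ ⟦ (p ∧ x) ∧ r ⟧ + ⟦ (p ∧ not x) ∧ r ⟧
    pt false x r = refl
    pt true false r = refl
    pt true true r = sym (+-identityʳ _)

  e-split-heads : ∀ {n} (G : Graph n) P Q X → e G P Q ≡ e G P (Q ∩ X) + e G P (Q ∖ X)
  e-split-heads G P Q X = begin
    e G P Q                                ≡⟨ e-ᵀ G Q P ⟨
    e (G ᵀ) Q P                            ≡⟨ e-split-tails (G ᵀ) Q P X ⟩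
    e (G ᵀ) (Q ∩ X) P + e (G ᵀ) (Q ∖ X) P  ≡⟨ cong₂ _+_ (e-ᵀ G _ P) (e-ᵀ G _ P) ⟩
    e G P (Q ∩ X) + e G P (Q ∖ X)          ∎
    where open ≡-Reasoning

  deg-split : ∀ {n} (G : Graph n) Q X u → deg G Q u ≡ deg G (Q ∩ X) u + deg G (Q ∖ X) u
  deg-split G Q X u = trans (∑-cong λ v → pt (Q v) (X v) (G u v)) (∑-+ _ _)
    where
    pt : ∀ p x r → ⟦ p ∧ r ⟧ ≡ ⟦ (p ∧ x) ∧ r ⟧ + ⟦ (p ∧ not x) ∧ r ⟧
    pt false x r = refl
    pt true false r = refl
    pt true true r = sym (+-identityʳ _)

  deg≤size : ∀ {n} (G : Graph n) Q u → deg G Q u ≤ size Q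
  deg≤size G Q u = size-mono λ v qg → proj₁ (∧-true qg)

  row : ∀ {n} (G : Graph n) (P Q : VSet n) u → P u ≡ true → size (λ v → P u ∧ (Q v ∧ G u v)) ≡ deg G Q u
  row G P Q u Pu rewrite Pu = refl

  deg≤e : ∀ {n} (G : Graph n) P Q u → P u ≡ true → deg G Q u ≤ e G P Q
  deg≤e G P Q u Pu = subst (_≤ e G P Q) (row G P Q u Pu) (term≤∑ _ u)

  deg-lower⇒e-lower : ∀ {n} (G : Graph n) P Q c → (∀ u → P u ≡ true → c ≤ deg G Q u) → size P * c ≤ e G P Q
  deg-lower⇒e-lower G P Q c h = ≤-trans (≤-reflexive (∑-*ʳ c _)) (∑-mono-≤ pt)
    where
    pt : ∀ u → ⟦ P u ⟧ * c ≤ size (λ v → P u ∧ (Q v ∧ G u v))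
    pt u with P u in Pu
    ... | false = z≤n
    ... | true = ≤-trans (≤-reflexive (*-identityˡ c)) (h u Pu)

  e≤size*size : ∀ {n} (G : Graph n) P Q → e G P Q ≤ size P * size Q
  e≤size*size {n} G P Q = ≤-trans (∑-mono-≤ pt) (≤-reflexive (sym (∑-*ʳ (size Q) _)))
    where
    pt : ∀ u → size (λ v → P u ∧ (Q v ∧ G u v)) ≤ ⟦ P u ⟧ * size Q
    pt u with P u
    ... | false = ≤-reflexive (trans (∑-const n 0) (*-zeroʳ n))
    ... | true = ≤-trans (deg≤size G Q u) (≤-reflexive (sym (*-identityˡ _)))

  e-empty : ∀ {n} (G : Graph n) P Q → (∀ u v → P u ≡ true → Q v ≡ true → G u v ≡ true → ⊥) → e G P Q ≡ 0
  e-empty {n} G P Q none = n≤0⇒n≡0 (begin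
    e G P Q                     ≤⟨ e-mono {G' = G} {P' = λ _ → false} {Q' = Q} (λ u v p q g → ⊥-elim (none u v p q g)) ⟩
    e G (λ _ → false) Q         ≤⟨ e≤size*size G _ Q ⟩
    size {n} (λ _ → false) * size Q ≡⟨ cong (_* size Q) (trans (∑-const n 0) (*-zeroʳ n)) ⟩
    0                           ∎)
    where open ≤-Reasoning

  e-delete-tail : ∀ {n} (G : Graph n) P Q u → P u ≡ true → e G P Q ≡ e G (delete u P) Q + deg G Q u
  e-delete-tail {n} G P Q u Pu = begin
    e G P Q                                         ≡⟨ +-identityʳ _ ⟨
    e G P Q + 0                                     ≡⟨ cong (e G P Q +_) (trans (∑-const n 0) (*-zeroʳ n)) ⟨
    e G P Q + size (λ v → false ∧ (Q v ∧ G u v))    ≡⟨ cong (λ b → e G P Q + size (λ v → b ∧ (Q v ∧ G u v))) (delete-self u P) ⟨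
    e G P Q + size (λ v → delete u P u ∧ (Q v ∧ G u v)) ≡⟨ ∑-exchange _ _ u (λ j j≢u → cong (λ b → size (λ v → b ∧ (Q v ∧ G j v))) (sym (delete-other u P j≢u))) ⟩
    e G (delete u P) Q + size (λ v → P u ∧ (Q v ∧ G u v)) ≡⟨ cong (e G (delete u P) Q +_) (row G P Q u Pu) ⟩
    e G (delete u P) Q + deg G Q u                  ∎
    where open ≡-Reasoning

  -- Two exchanges: the outer sums differ only in the row of `p`, and the two rows differ only in
  -- the entry at `q`.
  e-add-edge : ∀ {n} {f g : Graph n} {p q} → AgreeOff p q f g → f p q ≡ false → g p q ≡ true →
               ∀ P Q → e g P Q ≡ e f P Q + ⟦ P p ∧ Q q ⟧
  e-add-edge {n} {f} {g} {p} {q} agree fpq gpq P Q = +-cancelʳ-≡ (R f) _ _ (begin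
    e g P Q + R f                         ≡⟨ ∑-exchange _ _ p (λ a a≢p → ∑-cong λ b → cong (λ x → ⟦ P a ∧ (Q b ∧ x) ⟧) (sym (agree a b (a≢p ∘ proj₁)))) ⟩
    e f P Q + R g                         ≡⟨ cong (e f P Q +_) rows ⟩
    e f P Q + (R f + ⟦ P p ∧ Q q ⟧)       ≡⟨ perm (e f P Q) (R f) _ ⟩
    e f P Q + ⟦ P p ∧ Q q ⟧ + R f         ∎)
    where
    open ≡-Reasoning
    R : Graph n → ℕ
    R h = size (λ v → P p ∧ (Q v ∧ h p v))
    perm : ∀ a b c → a + (b + c) ≡ a + c + b
    perm = solve-∀
    rows : R g ≡ R f + ⟦ P p ∧ Q q ⟧
    rows = begin
      R g                                     ≡⟨ +-identityʳ _ ⟨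
      R g + 0                                 ≡⟨ cong (λ b → R g + ⟦ b ⟧) (trans (cong (λ x → P p ∧ (Q q ∧ x)) fpq) (trans (cong (P p ∧_) (Bool.∧-zeroʳ (Q q))) (Bool.∧-zeroʳ (P p)))) ⟨
      R g + ⟦ P p ∧ (Q q ∧ f p q) ⟧           ≡⟨ ∑-exchange _ _ q (λ b b≢q → cong (λ x → ⟦ P p ∧ (Q b ∧ x) ⟧) (sym (agree p b (b≢q ∘ proj₂)))) ⟩
      R f + ⟦ P p ∧ (Q q ∧ g p q) ⟧           ≡⟨ cong (λ x → R f + ⟦ P p ∧ x ⟧) (trans (cong (Q q ∧_) gpq) (Bool.∧-identityʳ (Q q))) ⟩
      R f + ⟦ P p ∧ Q q ⟧                     ∎

  e-∪ : ∀ {n} (f g : Graph n) P Q → e (f ∪ g) P Q ≤ e f P Q + e g P Q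
  e-∪ f g P Q = ≤-trans
    (∑-mono-≤ λ u → ≤-trans (∑-mono-≤ λ v → pt (P u) (Q v) (f u v) (g u v)) (≤-reflexive (∑-+ _ _)))
    (≤-reflexive (∑-+ _ _))
    where
    pt : ∀ p q a b → ⟦ p ∧ (q ∧ (a ∨ b)) ⟧ ≤ ⟦ p ∧ (q ∧ a) ⟧ + ⟦ p ∧ (q ∧ b) ⟧
    pt false q a b = z≤n
    pt true false a b = z≤n
    pt true true false b = ≤-refl
    pt true true true b = m≤m+n 1 _

  e-⋃ : ∀ {m n} (F : Fin m → Graph n) P Q → e (⋃ F) P Q ≤ ∑ (λ z → e (F z) P Q)
  e-⋃ F P Q = begin
    e (⋃ F) P Q                                                 ≤⟨ ∑-mono-≤ (λ u → ∑-mono-≤ (pt u)) ⟩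
    ∑ (λ u → ∑ (λ v → ∑ (λ z → ⟦ P u ∧ (Q v ∧ F z u v) ⟧)))     ≡⟨ ∑-cong (λ u → ∑-swap _) ⟩
    ∑ (λ u → ∑ (λ z → size (λ v → P u ∧ (Q v ∧ F z u v))))      ≡⟨ ∑-swap _ ⟩
    ∑ (λ z → e (F z) P Q)                                       ∎
    where
    open ≤-Reasoning
    pt : ∀ u v → ⟦ P u ∧ (Q v ∧ (⋃ F) u v) ⟧ ≤ ∑ (λ z → ⟦ P u ∧ (Q v ∧ F z u v) ⟧)
    pt u v with P u | Q v
    ... | false | _ = z≤n
    ... | true | false = z≤n
    ... | true | true with (⋃ F) u v in eq
    ...   | false = z≤n
    ...   | true =
      let z , Fz = ⋃⇒∃ F u v eq
      in ≤-trans (≤-reflexive (cong ⟦_⟧ (sym Fz))) (term≤∑ (λ z → ⟦ F z u v ⟧) z)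

  numEdges≡e : ∀ {n} (G : Graph n) → numEdges G ≡ e G (λ _ → true) (λ _ → true)
  numEdges≡e {n} G = begin
    List.sum (concatMap rowList (allFin n))      ≡⟨ flatten (allFin n) ⟩
    List.sum (map (List.sum ∘ rowList) (allFin n)) ≡⟨ cong List.sum (map-tabulate {n = n} id _) ⟩
    List.sum (tabulate (List.sum ∘ rowList))     ≡⟨ sum-tabulate _ ⟩
    ∑ (List.sum ∘ rowList)                       ≡⟨ ∑-cong (λ u → trans (cong List.sum (map-tabulate {n = n} id _)) (sum-tabulate _)) ⟩
    e G (λ _ → true) (λ _ → true)                ∎
    where
    open ≡-Reasoning
    rowList : Fin n → List ℕ
    rowList u = map (λ v → if G u v then 1 else 0) (allFin n)
    flatten : ∀ us → List.sum (concatMap rowList us) ≡ List.sum (map (List.sum ∘ rowList) us)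
    flatten [] = refl
    flatten (u ∷ᴸ us) = trans (sum-++ (rowList u) _) (cong (List.sum (rowList u) +_) (flatten us))

-- Flows and Menger's theorem

start∈vertices : ∀ {n} {G : Graph n} {s t} (w : Walk G s t) → s ∈ vertices w
start∈vertices [] = here refl
start∈vertices (_ ∷ _) = here refl

head∉tail : ∀ {A : Set} {x : A} {xs} → All (x ≢_) xs → x ∉ xs
head∉tail x≢ x∈ = All.lookup x≢ x∈ refl

PathOrCut : ∀ {n} → Graph n → Fin n → Fin n → Set
PathOrCut {n} G s t =
  Path G s t ⊎
  (Σ[ X ∈ VSet n ] X s ≡ true × X t ≡ false × (∀ a b → X a ≡ true → X b ≡ false → G a b ≡ false))

-- Backward search from `t`. A round takes `x` out of `S` if it has an edge to some `y` outside `S`;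
-- the known path from `y` avoids `S`, so prepending `x` keeps its vertices distinct. When no such
-- edge is left, either `s` has been reached or `S` is the closed set. `N` bounds the size of `S`
-- and makes the search end.
path-or-cut : ∀ {n} (G : Graph n) s t → PathOrCut G s t
path-or-cut {n} G s t =
  grow (size start) start ≤-refl (delete-self t _) λ x out → subst Reached (sym (only-t x out)) reach-t
  where
  start : VSet n
  start = delete t (λ _ → true)
  only-t : ∀ x → start x ≡ false → x ≡ t
  only-t x out with x ≟ t
  ... | yes x≡t = x≡t
  ... | no x≢t = ⊥-elim (true≢false (delete-other t _ x≢t) out)
  -- The set S holds the vertices from which t has not been reached yet.
  ReachedOff : VSet n → Fin n → Set
  ReachedOff S x = Σ[ p ∈ Path G x t ] (∀ y → y ∈ vertices (proj₁ p) → S y ≡ false)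
  Reached : Fin n → Set
  Reached = ReachedOff start
  reach-t : Reached t
  reach-t = ([] , [] ∷ []) , λ { y (here refl) → delete-self t _ }
  grow : ∀ N S → size S ≤ N → S t ≡ false → (∀ x → S x ≡ false → ReachedOff S x) → PathOrCut G s t
  grow N S size≤ St reached
    with any? (λ x → any? (λ y → (S x Bool.≟ true) ×-dec (S y Bool.≟ false) ×-dec (G x y Bool.≟ true)))
  ... | no none with S s in Ss
  ...   | false = inj₁ (proj₁ (reached s Ss))
  ...   | true = inj₂ (S , Ss , St , closed)
    where
    closed : ∀ a b → S a ≡ true → S b ≡ false → G a b ≡ false
    closed a b Sa Sb with G a b in Gab
    ... | false = refl
    ... | true = ⊥-elim (none (a , b , Sa , Sb , Gab))
  grow zero S size≤ St reached | yes (x , y , Sx , _) =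
    ⊥-elim (1+n≰n (≤-trans (s≤s z≤n) (≤-trans (≤-reflexive (sym (size-delete x S Sx))) size≤)))
  grow (suc N) S size≤ St reached | yes (x , y , Sx , Sy , Gxy) =
    grow N S' (s≤s⁻¹ (≤-trans (≤-reflexive (sym (size-delete x S Sx))) size≤)) (shrink St) reached'
    where
    S' : VSet n
    S' = delete x S
    shrink : ∀ {z} → S z ≡ false → S' z ≡ false
    shrink {z} Sz = trans (delete-other x S λ { refl → true≢false Sx Sz }) Sz
    reached' : ∀ z → S' z ≡ false → ReachedOff S' z
    reached' z S'z with z ≟ x
    ... | no z≢x =
      let p , off = reached z (trans (sym (delete-other x S z≢x)) S'z)
      in p , λ y y∈ → shrink (off y y∈)
    ... | yes refl =
      let (w , uniq) , off = reached y Sy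
      in (Gxy ∷ w , All.tabulate (λ {v} v∈ x≡v → true≢false Sx (subst (λ a → S a ≡ false) (sym x≡v) (off v v∈))) ∷ uniq)
       , λ { v (here refl) → delete-self x S ; v (there v∈) → shrink (off v v∈) }

-- Unit shifts and flows, described by cuts

out inn : ∀ {n} → Graph n → VSet n → ℕ
out f X = e f X (∁ X)
inn f X = e f (∁ X) X

opaque
  update : ∀ {n} → Fin n → Fin n → Bool → Graph n → Graph n
  update p q v f a b with a ≟ p | b ≟ q
  ... | yes _ | yes _ = v
  ... | yes _ | no _ = f a b
  ... | no _ | _ = f a b

  update-self : ∀ {n} (p q : Fin n) v f → update p q v f p q ≡ v
  update-self p q v f with p ≟ p | q ≟ q
  ... | yes _ | yes _ = refl
  ... | yes _ | no q≢q = ⊥-elim (q≢q refl)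
  ... | no p≢p | _ = ⊥-elim (p≢p refl)

  update-other : ∀ {n} (p q : Fin n) v f → AgreeOff p q (update p q v f) f
  update-other p q v f a b a,b≢ with a ≟ p | b ≟ q
  ... | yes a≡p | yes b≡q = ⊥-elim (a,b≢ (a≡p , b≡q))
  ... | yes _ | no _ = refl
  ... | no _ | _ = refl

  update-cases : ∀ {n} (p q : Fin n) v f a b →
                 (a ≡ p × b ≡ q × update p q v f a b ≡ v) ⊎ update p q v f a b ≡ f a b
  update-cases p q v f a b with a ≟ p | b ≟ q
  ... | yes a≡p | yes b≡q = inj₁ (a≡p , b≡q , refl)
  ... | yes _ | no _ = inj₂ refl
  ... | no _ | _ = inj₂ refl

-- f' carries one more unit from p to q than f does; stated without subtraction.
Shift : ∀ {n} → Graph n → Graph n → Fin n → Fin n → Set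
Shift f f' p q = ∀ X → out f' X + inn f X + ⟦ X q ⟧ ≡ out f X + inn f' X + ⟦ X p ⟧

shift-refl : ∀ {n} (f : Graph n) p → Shift f f p p
shift-refl f p X = refl

-- The new edge changes `out` minus `inn` by 1 if it leaves `X`, by -1 if it enters `X` and by 0
-- otherwise, which is `⟦ X p ⟧` minus `⟦ X q ⟧` in all four cases.
shift-add : ∀ {n} {f g : Graph n} {p q} → AgreeOff p q f g → f p q ≡ false → g p q ≡ true → Shift f g p q
shift-add {f = f} {g} {p} {q} agree fpq gpq X
  rewrite e-add-edge agree fpq gpq X (∁ X) | e-add-edge agree fpq gpq (∁ X) X =
  balance (out f X) (inn f X) (X p) (X q)
  where
  balance : ∀ o i a b → o + ⟦ a ∧ not b ⟧ + i + ⟦ b ⟧ ≡ o + (i + ⟦ not a ∧ b ⟧) + ⟦ a ⟧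
  balance o i false false = solve₀ o i
    where
    solve₀ : ∀ o i → o + 0 + i + 0 ≡ o + (i + 0) + 0
    solve₀ = solve-∀
  balance o i false true = solve₁ o i
    where
    solve₁ : ∀ o i → o + 0 + i + 1 ≡ o + (i + 1) + 0
    solve₁ = solve-∀
  balance o i true false = solve₂ o i
    where
    solve₂ : ∀ o i → o + 1 + i + 0 ≡ o + (i + 0) + 1
    solve₂ = solve-∀
  balance o i true true = solve₃ o i
    where
    solve₃ : ∀ o i → o + 0 + i + 1 ≡ o + (i + 0) + 1
    solve₃ = solve-∀

-- Adding the two equations and cancelling the terms of `g`. The endpoints stay arbitrary, so that a
-- path can be composed in either order: `shift-trans` and `shift-prepend`.
shift-sum : ∀ {n} {f g h : Graph n} {a b c d} → Shift f g a b → Shift g h c d →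
            ∀ X → out h X + inn f X + (⟦ X b ⟧ + ⟦ X d ⟧) ≡ out f X + inn h X + (⟦ X a ⟧ + ⟦ X c ⟧)
shift-sum {f = f} {g} {h} {a} {b} {c} {d} fg gh X = +-cancelʳ-≡ (out g X + inn g X) _ _ (begin
  out h X + inn f X + (⟦ X b ⟧ + ⟦ X d ⟧) + (out g X + inn g X)
    ≡⟨ perm (out h X) (inn f X) ⟦ X b ⟧ ⟦ X d ⟧ (out g X) (inn g X) ⟩
  (out g X + inn f X + ⟦ X b ⟧) + (out h X + inn g X + ⟦ X d ⟧)
    ≡⟨ cong₂ _+_ (fg X) (gh X) ⟩
  (out f X + inn g X + ⟦ X a ⟧) + (out g X + inn h X + ⟦ X c ⟧)
    ≡⟨ perm₂ (out f X) (inn h X) ⟦ X a ⟧ ⟦ X c ⟧ (out g X) (inn g X) ⟩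
  out f X + inn h X + (⟦ X a ⟧ + ⟦ X c ⟧) + (out g X + inn g X) ∎)
  where
  open ≡-Reasoning
  perm : ∀ oh if b d og ig → oh + if + (b + d) + (og + ig) ≡ (og + if + b) + (oh + ig + d)
  perm = solve-∀
  perm₂ : ∀ of ih a c og ig → (of + ig + a) + (og + ih + c) ≡ of + ih + (a + c) + (og + ig)
  perm₂ = solve-∀

shift-trans : ∀ {n} {f g h : Graph n} {p q t} → Shift f g p q → Shift g h q t → Shift f h p t
shift-trans {f = f} {h = h} {p} {q} {t} fg gh X =
  +-cancelʳ-≡ ⟦ X q ⟧ _ _ (trans (perm (out h X + inn f X) ⟦ X q ⟧ ⟦ X t ⟧) (trans (shift-sum fg gh X) (sym (+-assoc (out f X + inn h X) _ _))))
  where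
  perm : ∀ x q t → x + t + q ≡ x + (q + t)
  perm = solve-∀

shift-prepend : ∀ {n} {f g h : Graph n} {p q t} → Shift f g q t → Shift g h p q → Shift f h p t
shift-prepend {f = f} {h = h} {p} {q} {t} fg gh X =
  +-cancelʳ-≡ ⟦ X q ⟧ _ _ (trans (+-assoc (out h X + inn f X) _ _) (trans (shift-sum fg gh X) (perm (out f X + inn h X) ⟦ X p ⟧ ⟦ X q ⟧)))
  where
  perm : ∀ x p q → x + (q + p) ≡ x + p + q
  perm = solve-∀

shift-sym : ∀ {n} {f g : Graph n} {p q} → Shift f g p q → Shift g f q p
shift-sym fg X = sym (fg X)

-- An integral flow of value `j` with unit capacities, given by its edge set. Conservation is
-- required for the net flow out of every vertex set; singletons give the usual condition at each
-- vertex.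
Balanced : ∀ {n} → Graph n → Fin n → Fin n → ℕ → Set
Balanced f s t j = ∀ X → out f X + j * ⟦ X t ⟧ ≡ inn f X + j * ⟦ X s ⟧

balanced-zero : ∀ {n} (s t : Fin n) → Balanced (λ _ _ → false) s t 0
balanced-zero s t X = cong (_+ 0) (trans (e-empty _ X (∁ X) λ _ _ _ _ ()) (sym (e-empty _ (∁ X) X λ _ _ _ _ ())))

balanced-suc : ∀ {n} {f f' : Graph n} {s t j} → Balanced f s t j → Shift f f' s t → Balanced f' s t (suc j)
balanced-suc {f = f} {f'} {s} {t} {j} bal shift X = +-cancelʳ-≡ (out f X + inn f X) _ _ (begin
  out f' X + suc j * ⟦ X t ⟧ + (out f X + inn f X)
    ≡⟨ perm (out f' X) (inn f X) (out f X) j ⟦ X t ⟧ ⟩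
  (out f' X + inn f X + ⟦ X t ⟧) + (out f X + j * ⟦ X t ⟧)
    ≡⟨ cong₂ _+_ (shift X) (bal X) ⟩
  (out f X + inn f' X + ⟦ X s ⟧) + (inn f X + j * ⟦ X s ⟧)
    ≡⟨ perm₂ (inn f' X) (inn f X) (out f X) j ⟦ X s ⟧ ⟩
  inn f' X + suc j * ⟦ X s ⟧ + (out f X + inn f X) ∎)
  where
  open ≡-Reasoning
  perm : ∀ o' i o j t → o' + suc j * t + (o + i) ≡ (o' + i + t) + (o + j * t)
  perm = solve-∀
  perm₂ : ∀ i' i o j s → (o + i' + s) + (i + j * s) ≡ i' + suc j * s + (o + i)
  perm₂ = solve-∀

balanced-pred : ∀ {n} {f f' : Graph n} {s t j} → Balanced f s t (suc j) → Shift f' f s t → Balanced f' s t j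
balanced-pred {f = f} {f'} {s} {t} {j} bal shift X = +-cancelʳ-≡ (inn f X + ⟦ X s ⟧) _ _ (begin
  out f' X + j * ⟦ X t ⟧ + (inn f X + ⟦ X s ⟧)
    ≡⟨ perm (out f' X) (inn f X) ⟦ X s ⟧ (j * ⟦ X t ⟧) ⟩
  (out f' X + inn f X + ⟦ X s ⟧) + j * ⟦ X t ⟧
    ≡⟨ cong (_+ j * ⟦ X t ⟧) (shift X) ⟨
  (out f X + inn f' X + ⟦ X t ⟧) + j * ⟦ X t ⟧
    ≡⟨ perm₂ (out f X) (inn f' X) j ⟦ X t ⟧ ⟩
  inn f' X + (out f X + suc j * ⟦ X t ⟧)
    ≡⟨ cong (inn f' X +_) (bal X) ⟩
  inn f' X + (inn f X + suc j * ⟦ X s ⟧)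
    ≡⟨ perm₃ (inn f' X) (inn f X) j ⟦ X s ⟧ ⟩
  inn f' X + j * ⟦ X s ⟧ + (inn f X + ⟦ X s ⟧) ∎)
  where
  open ≡-Reasoning
  perm : ∀ o' i s y → o' + y + (i + s) ≡ (o' + i + s) + y
  perm = solve-∀
  perm₂ : ∀ o i' j t → (o + i' + t) + j * t ≡ i' + (o + suc j * t)
  perm₂ = solve-∀
  perm₃ : ∀ i' i j s → i' + (i + suc j * s) ≡ i' + j * s + (i + s)
  perm₃ = solve-∀

-- Augmenting along paths, peeling off paths, and minimum cuts

residual : ∀ {n} → Graph n → Graph n → Graph n
residual G f p q = f q p ∨ (G p q ∧ not (f p q))

-- The tail of the walk is processed first. Since `p` does not occur on it, the last component says
-- that pairs containing `p` still have their old values. The first arc `p` to `q` then either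
-- cancels the flow edge from `q` to `p`, if there is one, or adds the edge from `p` to `q`; both
-- move one unit from `p` to `q`.
augment : ∀ {n} {G f : Graph n} {p t} (w : Walk (residual G f) p t) → f ⊆G G → Unique (vertices w) →
          Σ[ f' ∈ Graph n ] f' ⊆G G × Shift f f' p t ×
            (∀ a b → a ∉ vertices w ⊎ b ∉ vertices w → f' a b ≡ f a b)
augment {f = f} [] f⊆G _ = f , f⊆G , shift-refl f _ , λ _ _ _ → refl
augment {n} {G} {f} {p} {t} (_∷_ {u = q} r w) f⊆G (p≢ ∷ uniq) with augment w f⊆G uniq
... | g , g⊆G , f→g , agree with f q p in fqp
...   | true = g' , g'⊆G , shift-prepend f→g (shift-sym (shift-add (update-other q p false g) (update-self q p false g) gqp)) , agree'
  where
  p∉ : p ∉ vertices w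
  p∉ = head∉tail p≢
  g' : Graph n
  g' = update q p false g
  gqp : g q p ≡ true
  gqp = trans (agree q p (inj₂ p∉)) fqp
  g'⊆G : g' ⊆G G
  g'⊆G a b g'ab with update-cases q p false g a b
  ... | inj₁ (_ , _ , eq) = ⊥-elim (true≢false g'ab eq)
  ... | inj₂ eq = g⊆G a b (trans (sym eq) g'ab)
  agree' : ∀ a b → a ∉ _ ⊎ b ∉ _ → g' a b ≡ f a b
  agree' a b (inj₁ a∉) = trans (update-other q p false g a b λ { (refl , _) → a∉ (there (start∈vertices w)) }) (agree a b (inj₁ (a∉ ∘ there)))
  agree' a b (inj₂ b∉) = trans (update-other q p false g a b λ { (_ , refl) → b∉ (here refl) }) (agree a b (inj₂ (b∉ ∘ there)))
...   | false = g' , g'⊆G , shift-prepend f→g (shift-add (λ a b ne → sym (update-other p q true g a b ne)) gpq (update-self p q true g)) , agree'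
  where
  p∉ : p ∉ vertices w
  p∉ = head∉tail p≢
  g' : Graph n
  g' = update p q true g
  gpq : g p q ≡ false
  gpq = trans (agree p q (inj₁ p∉)) (not-true (proj₂ (∧-true {G p q} r)))
  g'⊆G : g' ⊆G G
  g'⊆G a b g'ab with update-cases p q true g a b
  ... | inj₁ (refl , refl , _) = proj₁ (∧-true r)
  ... | inj₂ eq = g⊆G a b (trans (sym eq) g'ab)
  agree' : ∀ a b → a ∉ _ ⊎ b ∉ _ → g' a b ≡ f a b
  agree' a b (inj₁ a∉) = trans (update-other p q true g a b λ { (refl , _) → a∉ (here refl) }) (agree a b (inj₁ (a∉ ∘ there)))
  agree' a b (inj₂ b∉) = trans (update-other p q true g a b λ { (_ , refl) → b∉ (there (start∈vertices w)) }) (agree a b (inj₂ (b∉ ∘ there)))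

-- As in `augment`, the tail goes first; the last component guarantees that the first edge is still
-- present when its turn comes, because its tail `p` is not on the rest of the walk.
peel : ∀ {n} {f : Graph n} {p t} (w : Walk f p t) → Unique (vertices w) →
       Σ[ f' ∈ Graph n ] f' ⊆G f × Shift f' f p t ×
         (∀ a b → (a , b) ∈ edges w → f' a b ≡ false) × (∀ a b → a ∉ vertices w → f' a b ≡ f a b)
peel {f = f} [] _ = f , (λ _ _ → id) , shift-refl f _ , (λ _ _ ()) , λ _ _ _ → refl
peel {n} {f} {p} {t} (_∷_ {u = q} fpq w) (p≢ ∷ uniq) with peel w uniq
... | g , g⊆f , g→f , gone , agree =
  g' , (λ a b → g⊆f a b ∘ g'⊆g a b) , shift-trans (shift-add (update-other p q false g) (update-self p q false g) gpq) g→f , gone' , agree'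
  where
  g' : Graph n
  g' = update p q false g
  gpq : g p q ≡ true
  gpq = trans (agree p q (head∉tail p≢)) fpq
  g'⊆g : g' ⊆G g
  g'⊆g a b g'ab with update-cases p q false g a b
  ... | inj₁ (_ , _ , eq) = ⊥-elim (true≢false g'ab eq)
  ... | inj₂ eq = trans (sym eq) g'ab
  gone' : ∀ a b → (a , b) ∈ (p , q) ∷ᴸ edges w → g' a b ≡ false
  gone' a b (here refl) = update-self p q false g
  gone' a b (there ab∈) with update-cases p q false g a b
  ... | inj₁ (_ , _ , eq) = eq
  ... | inj₂ eq = trans eq (gone a b ab∈)
  agree' : ∀ a b → a ∉ p ∷ᴸ vertices w → g' a b ≡ f a b
  agree' a b a∉ = trans (update-other p q false g a b λ { (refl , _) → a∉ (here refl) }) (agree a b (a∉ ∘ there))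

-- The cut side of Menger's theorem, equivalent to `FlowAtLeast` by `conn⇒paths` and `paths⇒conn`.
-- In this form transitivity and the effect of deleting an edge are read off from single cuts.
Conn : ∀ {n} → Graph n → Fin n → Fin n → ℕ → Set
Conn G s t j = ∀ X → X s ≡ true → X t ≡ false → j ≤ out G X

balanced⇒conn : ∀ {n} {f : Graph n} {s t j} → Balanced f s t j → Conn f s t j
balanced⇒conn {f = f} {s} {t} {j} bal X Xs Xt = begin
  j                        ≡⟨ *-identityʳ j ⟨
  j * 1                    ≡⟨ cong (λ b → j * ⟦ b ⟧) Xs ⟨
  j * ⟦ X s ⟧              ≤⟨ m≤n+m _ _ ⟩
  inn f X + j * ⟦ X s ⟧    ≡⟨ bal X ⟨
  out f X + j * ⟦ X t ⟧    ≡⟨ cong (λ b → out f X + j * ⟦ b ⟧) Xt ⟩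
  out f X + j * 0          ≡⟨ trans (cong (out f X +_) (*-zeroʳ j)) (+-identityʳ _) ⟩
  out f X                  ∎
  where open ≤-Reasoning

-- Max-flow min-cut, one augmentation per unit. If the residual graph has no path from `s` to `t`,
-- its closed set `X` has all leaving edges of `G` used by `f` and no entering edge in `f`, so
-- balance gives `out G X ≤ j`.
flow-or-cut : ∀ {n} (G : Graph n) s t j →
  (Σ[ f ∈ Graph n ] f ⊆G G × Balanced f s t j) ⊎
  (Σ[ X ∈ VSet n ] X s ≡ true × X t ≡ false × out G X < j)
flow-or-cut G s t zero = inj₁ ((λ _ _ → false) , (λ _ _ ()) , balanced-zero s t)
flow-or-cut G s t (suc j) with flow-or-cut G s t j
... | inj₂ (X , Xs , Xt , out<) = inj₂ (X , Xs , Xt , m<n⇒m<1+n out<)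
... | inj₁ (f , f⊆G , bal) with path-or-cut (residual G f) s t
...   | inj₁ (w , uniq) =
        let f' , f'⊆G , shift , _ = augment w f⊆G uniq
        in inj₁ (f' , f'⊆G , balanced-suc {f = f} {f' = f'} {j = j} bal shift)
...   | inj₂ (X , Xs , Xt , closed) = inj₂ (X , Xs , Xt , s≤s (begin
        out G X                  ≤⟨ e-mono saturated ⟩
        out f X                  ≤⟨ m≤m+n _ _ ⟩
        out f X + j * ⟦ X t ⟧    ≡⟨ bal X ⟩
        inn f X + j * ⟦ X s ⟧    ≡⟨ cong₂ (λ i b → i + j * ⟦ b ⟧) (e-empty f (∁ X) X no-entry) Xs ⟩
        j * 1                    ≡⟨ *-identityʳ j ⟩
        j                        ∎))
  where
  open ≤-Reasoning
  saturated : ∀ u v → X u ≡ true → ∁ X v ≡ true → G u v ≡ true → X u ≡ true × ∁ X v ≡ true × f u v ≡ true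
  saturated u v Xu ∁Xv Guv with closed u v Xu (not-true ∁Xv)
  ... | res rewrite Guv with f v u | f u v
  ...   | false | true = Xu , ∁Xv , refl
  no-entry : ∀ u v → ∁ X u ≡ true → X v ≡ true → f u v ≡ true → ⊥
  no-entry u v ∁Xu Xv fuv with closed v u Xv (not-true ∁Xu)
  ... | res rewrite fuv with res
  ...   | ()

-- Edge-disjoint paths from flows, and Menger's theorem in both directions

walk-⊆ : ∀ {n} {G H : Graph n} → G ⊆G H → ∀ {s t} → Walk G s t → Walk H s t
walk-⊆ G⊆H [] = []
walk-⊆ G⊆H (g ∷ w) = G⊆H _ _ g ∷ walk-⊆ G⊆H w

vertices-⊆ : ∀ {n} {G H : Graph n} (G⊆H : G ⊆G H) {s t} (w : Walk G s t) → vertices (walk-⊆ G⊆H w) ≡ vertices w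
vertices-⊆ G⊆H [] = refl
vertices-⊆ G⊆H (g ∷ w) = cong (_ ∷ᴸ_) (vertices-⊆ G⊆H w)

edges-⊆ : ∀ {n} {G H : Graph n} (G⊆H : G ⊆G H) {s t} (w : Walk G s t) → edges (walk-⊆ G⊆H w) ≡ edges w
edges-⊆ G⊆H [] = refl
edges-⊆ G⊆H (g ∷ w) = cong (_ ∷ᴸ_) (edges-⊆ G⊆H w)

path-⊆ : ∀ {n} {G H : Graph n} → G ⊆G H → ∀ {s t} → Path G s t → Path H s t
path-⊆ G⊆H (w , uniq) = walk-⊆ G⊆H w , subst Unique (sym (vertices-⊆ G⊆H w)) uniq

∈edges⇒edge : ∀ {n} {G : Graph n} {s t} (w : Walk G s t) {a b} → (a , b) ∈ edges w → G a b ≡ true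
∈edges⇒edge (g ∷ w) (here refl) = g
∈edges⇒edge (g ∷ w) (there ab∈) = ∈edges⇒edge w ab∈

flowAtLeast-⊆ : ∀ {n} {G H : Graph n} → G ⊆G H → ∀ {s t j} → FlowAtLeast G s t j → FlowAtLeast H s t j
flowAtLeast-⊆ G⊆H (P , disjoint) =
  path-⊆ G⊆H ∘ P , λ i j i≢j ab ab∈i ab∈j →
    disjoint i j i≢j ab (subst (ab ∈_) (edges-⊆ G⊆H _) ab∈i) (subst (ab ∈_) (edges-⊆ G⊆H _) ab∈j)

-- Flow decomposition: a closed set would be a cut without leaving edges, against the positive
-- value, so there is a path. Peeling it lowers the value by one and removes its edges, hence the
-- paths found in `f'` are disjoint from it.
balanced⇒paths : ∀ {n} (f : Graph n) s t j → Balanced f s t j → FlowAtLeast f s t j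
balanced⇒paths f s t zero bal = (λ ()) , λ ()
balanced⇒paths f s t (suc j) bal with path-or-cut f s t
... | inj₂ (X , Xs , Xt , closed) = ⊥-elim (1+n≰n (≤-trans (s≤s z≤n) (≤-trans (balanced⇒conn {f = f} {j = suc j} bal X Xs Xt)
        (≤-reflexive (e-empty f X (∁ X) λ u v Xu ∁Xv fuv → true≢false fuv (closed u v Xu (not-true ∁Xv)))))))
... | inj₁ p with peel (proj₁ p) (proj₂ p)
...   | f' , f'⊆f , shift , gone , _ with balanced⇒paths f' s t j (balanced-pred {f = f} {f' = f'} {j = j} bal shift)
...     | P' , disjoint' = P , disjoint
  where
  P : Fin (suc j) → Path f s t
  P zero = p
  P (suc i) = path-⊆ f'⊆f (P' i)
  apart : ∀ i → EdgeDisjoint p (P (suc i))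
  apart i (a , b) ab∈p ab∈i = true≢false (∈edges⇒edge (proj₁ (P' i)) (subst ((a , b) ∈_) (edges-⊆ f'⊆f _) ab∈i)) (gone a b ab∈p)
  disjoint : ∀ i i' → i ≢ i' → EdgeDisjoint (P i) (P i')
  disjoint zero zero ne = ⊥-elim (ne refl)
  disjoint zero (suc i') ne = apart i'
  disjoint (suc i) zero ne ab ab∈ ab∈' = apart i ab ab∈' ab∈
  disjoint (suc i) (suc i') ne = proj₂ (flowAtLeast-⊆ f'⊆f (P' , disjoint')) i i' (ne ∘ cong suc)

conn⇒paths : ∀ {n} {G : Graph n} {s t j} → Conn G s t j → FlowAtLeast G s t j
conn⇒paths {G = G} {s} {t} {j} conn with flow-or-cut G s t j
... | inj₁ (f , f⊆G , bal) = flowAtLeast-⊆ f⊆G (balanced⇒paths f s t j bal)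
... | inj₂ (X , Xs , Xt , out<j) = ⊥-elim (<⇒≱ out<j (conn X Xs Xt))

-- Induction on `j`: deleting the edge `c zero` lowers the count by one and, by distinctness, leaves
-- all other listed edges in place.
distinct-edges≤e : ∀ {n} (G : Graph n) P Q j (c : Fin j → Fin n × Fin n) →
  (∀ i → let a , b = c i in P a ≡ true × Q b ≡ true × G a b ≡ true) →
  (∀ i i' → i ≢ i' → c i ≢ c i') → j ≤ e G P Q
distinct-edges≤e G P Q zero c edge distinct = z≤n
distinct-edges≤e G P Q (suc j) c edge distinct = begin
  suc j                                    ≤⟨ s≤s (distinct-edges≤e G' P Q j (c ∘ suc) edge' (λ i i' ne → distinct (suc i) (suc i') λ { refl → ne refl })) ⟩
  suc (e G' P Q)                           ≡⟨ +-comm 1 _ ⟩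
  e G' P Q + 1                             ≡⟨ cong (λ b → e G' P Q + ⟦ b ⟧) (true-∧ (proj₁ (edge zero)) (proj₁ (proj₂ (edge zero)))) ⟨
  e G' P Q + ⟦ P a₀ ∧ Q b₀ ⟧               ≡⟨ e-add-edge (update-other a₀ b₀ false G) (update-self a₀ b₀ false G) (proj₂ (proj₂ (edge zero))) P Q ⟨
  e G P Q                                  ∎
  where
  open ≤-Reasoning
  a₀ = proj₁ (c zero)
  b₀ = proj₂ (c zero)
  G' = update a₀ b₀ false G
  edge' : ∀ i → let a , b = c (suc i) in P a ≡ true × Q b ≡ true × G' a b ≡ true
  edge' i = let Pa , Qb , Gab = edge (suc i) in
    Pa , Qb , trans (update-other a₀ b₀ false G _ _ λ { (a≡ , b≡) → distinct (suc i) zero (λ ()) (cong₂ _,_ a≡ b≡) }) Gab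

crossing : ∀ {n} {G : Graph n} {s t} (w : Walk G s t) (X : VSet n) → X s ≡ true → X t ≡ false →
           Σ[ ab ∈ Fin n × Fin n ] ab ∈ edges w × X (proj₁ ab) ≡ true × X (proj₂ ab) ≡ false
crossing [] X Xs Xt = ⊥-elim (true≢false Xs Xt)
crossing {s = s} (_∷_ {u = u} g w) X Xs Xt with X u in Xu
... | false = (s , u) , here refl , Xs , Xu
... | true = let ab , ab∈ , Xa , Xb = crossing w X Xu Xt in ab , there ab∈ , Xa , Xb

-- Each path leaves `X` along some edge, and disjointness makes these edges distinct.
paths⇒conn : ∀ {n} {G : Graph n} {s t j} → FlowAtLeast G s t j → Conn G s t j
paths⇒conn {n} {G} {j = j} (P , disjoint) X Xs Xt = distinct-edges≤e G X (∁ X) j (proj₁ ∘ cross)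
  (λ i → let _ , ab∈ , Xa , Xb = cross i in Xa , cong not Xb , ∈edges⇒edge (proj₁ (P i)) ab∈)
  (λ i i' ne eq → disjoint i i' ne _ (proj₁ (proj₂ (cross i))) (subst (_∈ edges (proj₁ (P i'))) (sym eq) (proj₁ (proj₂ (cross i')))))
  where
  cross : ∀ i → Σ[ ab ∈ Fin n × Fin n ] ab ∈ edges (proj₁ (P i)) × X (proj₁ ab) ≡ true × X (proj₂ ab) ≡ false
  cross i = crossing (proj₁ (P i)) X Xs Xt

-- Critical graphs

conn-refl : ∀ {n} {G : Graph n} {s j} → Conn G s s j
conn-refl X Xs ¬Xs = ⊥-elim (true≢false Xs ¬Xs)

-- A cut between `x` and `z` separates `y` from one of them. This is the ultrametric inequality for
-- connectivity.
conn-trans : ∀ {n} {G : Graph n} {x y z j} → Conn G x y j → Conn G y z j → Conn G x z j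
conn-trans {y = y} xy yz X Xx Xz with X y in Xy
... | true = yz X Xy Xz
... | false = xy X Xx Xy

conn-≤ : ∀ {n} {G : Graph n} {s t i j} → i ≤ j → Conn G s t j → Conn G s t i
conn-≤ i≤j conn X Xs Xt = ≤-trans i≤j (conn X Xs Xt)

conn-⊆ : ∀ {n} {G H : Graph n} → G ⊆G H → ∀ {s t j} → Conn G s t j → Conn H s t j
conn-⊆ G⊆H conn X Xs Xt = ≤-trans (conn X Xs Xt) (e-mono λ u v p q g → p , q , G⊆H u v g)

conn? : ∀ {n} (G : Graph n) s t j → Dec (Conn G s t j)
conn? G s t j with flow-or-cut G s t j
... | inj₁ (f , f⊆G , bal) = yes (conn-⊆ f⊆G (balanced⇒conn {j = j} bal))
... | inj₂ (X , Xs , Xt , out<j) = no λ conn → <⇒≱ out<j (conn X Xs Xt)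

conn⇒flow : ∀ {n} {G : Graph n} {s t j} → Conn G s t j → Σ[ f ∈ Graph n ] f ⊆G G × Balanced f s t j
conn⇒flow {G = G} {s} {t} {j} conn with flow-or-cut G s t j
... | inj₁ flow = flow
... | inj₂ (X , Xs , Xt , out<j) = ⊥-elim (<⇒≱ out<j (conn X Xs Xt))

-- The inequality `λ_G(s,t) ≥ j` in cut form; the cap at `k` enters separately as `j ≤ k`.
Lam : ∀ {n} → Graph n → Fin n → Fin n → ℕ → Set
Lam G s t j = Conn G s t j × Conn G t s j

-- A subgraph cannot raise any connectivity, so only lower bounds have to survive, and Menger's
-- theorem lets this be checked on cuts.
preserver : ∀ {n k} {H H' : Graph n} → H' ⊆G H → (∀ s t j → j ≤ k → Lam H s t j → Lam H' s t j) → IsPreserver k H H'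
preserver {H = H} {H'} H'⊆H keep = H'⊆H , λ s t j → mk⇔
  (λ (j≤k , st , ts) → j≤k , flowAtLeast-⊆ H'⊆H st , flowAtLeast-⊆ H'⊆H ts)
  (λ (j≤k , st , ts) → let st' , ts' = keep s t j j≤k (paths⇒conn st , paths⇒conn ts)
                       in j≤k , conn⇒paths st' , conn⇒paths ts')

edge-in-small-cut : ∀ {n k} {H : Graph n} → IsCritical k H → ∀ u v → H u v ≡ true →
                    Σ[ X ∈ VSet n ] X u ≡ true × X v ≡ false × out H X ≤ k
edge-in-small-cut {n} {k} {H} critical u v Huv with flow-or-cut H u v (suc k)
... | inj₂ (X , Xu , Xv , out<) = X , Xu , Xv , s≤s⁻¹ out<
... | inj₁ (f , f⊆H , bal) = ⊥-elim (critical H' H'⊆H (u , v , Huv , update-self u v false H)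
        (preserver H'⊆H λ s t j j≤k (st , ts) → keep j≤k st , keep j≤k ts))
  where
  H' : Graph n
  H' = update u v false H
  H'⊆H : H' ⊆G H
  H'⊆H a b H'ab with update-cases u v false H a b
  ... | inj₁ (_ , _ , eq) = ⊥-elim (true≢false H'ab eq)
  ... | inj₂ eq = trans (sym eq) H'ab
  out≡ : ∀ X → out H X ≡ out H' X + ⟦ X u ∧ ∁ X v ⟧
  out≡ X = e-add-edge (update-other u v false H) (update-self u v false H) Huv X (∁ X)
  connected : Conn H u v (suc k)
  connected = conn-⊆ f⊆H (balanced⇒conn {j = suc k} bal)
  keep : ∀ {s t j} → j ≤ k → Conn H s t j → Conn H' s t j
  keep {j = j} j≤k conn X Xs Xt with X u ∧ ∁ X v in eq
  ... | false = ≤-trans (conn X Xs Xt) (≤-reflexive (trans (out≡ X) (trans (cong (λ b → out H' X + ⟦ b ⟧) eq) (+-identityʳ _))))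
  -- The deleted edge leaves `X`, so `X` separates `u` from `v` and had at least `suc k` leaving
  -- edges; `k` of them remain, enough for `j ≤ k`.
  ... | true = ≤-trans j≤k (s≤s⁻¹ (≤-trans (connected X (proj₁ (∧-true eq)) (not-true (proj₂ (∧-true eq))))
                 (≤-reflexive (trans (out≡ X) (trans (cong (λ b → out H' X + ⟦ b ⟧) eq) (+-comm _ 1))))))

balanced-inn≤ : ∀ {n k j} {f H : Graph n} {s t} → f ⊆G H → j ≤ k → Balanced f s t j →
                ∀ X → out H X ≤ k → inn f X ≤ k + k
balanced-inn≤ {k = k} {j} {f} {H} {s} {t} f⊆H j≤k bal X out≤k = begin
  inn f X                  ≤⟨ m≤m+n _ _ ⟩
  inn f X + j * ⟦ X s ⟧    ≡⟨ bal X ⟨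
  out f X + j * ⟦ X t ⟧    ≤⟨ +-mono-≤ (≤-trans (e-mono λ u v p q g → p , q , f⊆H u v g) out≤k)
                                (≤-trans (*-mono-≤ j≤k (⟦⟧≤1 (X t))) (≤-reflexive (*-identityʳ k))) ⟩
  k + k                    ∎
  where open ≤-Reasoning

∪-⊆ : ∀ {n} {f g H : Graph n} → f ⊆G H → g ⊆G H → (f ∪ g) ⊆G H
∪-⊆ {f = f} f⊆H g⊆H u v fg with f u v in fuv
... | true = f⊆H u v fuv
... | false = g⊆H u v fg

-- A preserver made of flows along a maximum spanning tree

module _ {n} (k : ℕ) (H : Graph n) where

  -- Whatever level up to `b` the vertex `v` shares in `H` with an earlier vertex, `F` realises it
  -- with some earlier `w`, possibly a different one. Earlier means of smaller index.
  Near : Graph n → Fin n → ℕ → Set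
  Near F v b = ∀ x i → toℕ x < toℕ v → i ≤ b → Lam H v x i → Σ[ w ∈ Fin n ] toℕ w < toℕ v × Lam F v w i

  -- The bound `4 * k` pays for two flows, one in each direction, each entering `X` at most `k + k`
  -- times.
  Attachment : Fin n → ℕ → Set
  Attachment v b = Σ[ F ∈ Graph n ] F ⊆G H × (∀ X → out H X ≤ k → inn F X ≤ 4 * k) × Near F v b

  -- Greedy choice of a tree edge: the level descends from `b` until some earlier `w` has that
  -- connectivity with `v`, and the flows between them are taken. At the levels skipped no earlier
  -- vertex qualifies, so `Near` holds there vacuously.
  attach : ∀ v b → b ≤ k → Attachment v b
  attach v zero _ = (λ _ _ → false) , (λ _ _ ()) ,
    (λ X _ → ≤-trans (≤-reflexive (e-empty _ (∁ X) X λ _ _ _ _ ())) z≤n) ,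
    -- At level 0 the vertex `x` itself serves as `w`, with the empty graph.
    λ { x .0 x<v z≤n _ → x , x<v , (λ _ _ _ → z≤n) , (λ _ _ _ → z≤n) }
  attach v (suc b) b<k
    with any? (λ w → (toℕ w <? toℕ v) ×-dec (conn? H v w (suc b) ×-dec conn? H w v (suc b)))
  ... | yes (w , w<v , vw , wv) =
    let f , f⊆H , bal-f = conn⇒flow vw
        g , g⊆H , bal-g = conn⇒flow wv
    in (f ∪ g) , ∪-⊆ f⊆H g⊆H
     , (λ X out≤k → ≤-trans (e-∪ f g (∁ X) X) (≤-trans
          (+-mono-≤ (balanced-inn≤ f⊆H b<k bal-f X out≤k) (balanced-inn≤ g⊆H b<k bal-g X out≤k))
          (≤-reflexive (four k))))
     , λ x i _ i≤ _ → w , w<v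
       , conn-≤ i≤ (conn-⊆ (λ u v fuv → cong (_∨ g u v) fuv) (balanced⇒conn {j = suc b} bal-f))
       , conn-≤ i≤ (conn-⊆ (λ u v guv → trans (cong (f u v ∨_) guv) (Bool.∨-zeroʳ _)) (balanced⇒conn {j = suc b} bal-g))
    where
    four : ∀ k → (k + k) + (k + k) ≡ 4 * k
    four = solve-∀
  ... | no none =
    let F , F⊆H , cheap , near = attach v b (<⇒≤ b<k)
    in F , F⊆H , cheap , extend near
    where
    extend : ∀ {F} → Near F v b → Near F v (suc b)
    extend near x i x<v i≤ lam with m≤n⇒m<n∨m≡n i≤
    ... | inj₁ i<sb = near x i x<v (s≤s⁻¹ i<sb) lam
    ... | inj₂ refl = ⊥-elim (none (x , x<v , lam))

  piece : Fin n → Graph n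
  piece v = proj₁ (attach v k ≤-refl)

  skeleton : Graph n
  skeleton = ⋃ piece

  skeleton⊆ : skeleton ⊆G H
  skeleton⊆ u v uv = let z , zuv = ⋃⇒∃ piece u v uv in proj₁ (proj₂ (attach z k ≤-refl)) u v zuv

  skeleton-inn≤ : ∀ X → out H X ≤ k → inn skeleton X ≤ n * (4 * k)
  skeleton-inn≤ X out≤k = ≤-trans (e-⋃ piece (∁ X) X) (≤-trans
    (∑-mono-≤ (λ v → proj₁ (proj₂ (proj₂ (attach v k ≤-refl))) X out≤k)) (≤-reflexive (∑-const n _)))

  -- λ is an ultrametric, so the attachments form a maximum spanning tree.
  skeleton-lam : ∀ N s t i → toℕ s + toℕ t < N → i ≤ k → Lam H s t i → Lam skeleton s t i
  skeleton-lam (suc N) s t i s+t<N i≤k lam@(st , ts) with <-cmp (toℕ s) (toℕ t)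
  ... | tri≈ _ s≡t _ with toℕ-injective s≡t
  ...   | refl = conn-refl , conn-refl
  skeleton-lam (suc N) s t i s+t<N i≤k lam@(st , ts) | tri> _ _ t<s =
    -- The later vertex `s` is traded for the earlier `w`. In `H` the level `i` between `w` and `t`
    -- follows through `s`, and the sum of the indices has dropped, so induction applies.
    let F , F⊆H , _ , near = attach s k ≤-refl
        w , w<s , sw , ws = near t i t<s i≤k lam
        F⊆ = ⊆-⋃ piece s
        wt , tw = skeleton-lam N w t i (≤-trans (+-monoˡ-< (toℕ t) w<s) (s≤s⁻¹ s+t<N)) i≤k
                    (conn-trans (conn-⊆ F⊆H ws) st , conn-trans ts (conn-⊆ F⊆H sw))
    in conn-trans (conn-⊆ F⊆ sw) wt , conn-trans tw (conn-⊆ F⊆ ws)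
  skeleton-lam (suc N) s t i s+t<N i≤k lam@(st , ts) | tri< s<t _ _ =
    let F , F⊆H , _ , near = attach t k ≤-refl
        w , w<t , tw , wt = near s i s<t i≤k (ts , st)
        F⊆ = ⊆-⋃ piece t
        sw , ws = skeleton-lam N s w i (≤-trans (+-monoʳ-< (toℕ s) w<t) (s≤s⁻¹ s+t<N)) i≤k
                    (conn-trans st (conn-⊆ F⊆H tw) , conn-trans (conn-⊆ F⊆H wt) ts)
    in conn-trans sw (conn-⊆ F⊆ wt) , conn-trans (conn-⊆ F⊆ tw) ws

  critical-inn≤ : IsCritical k H → ∀ X → out H X ≤ k → inn H X ≤ n * (4 * k)
  critical-inn≤ critical X out≤k = ≤-trans (e-mono λ u v p q g → p , q , covered u v g) (skeleton-inn≤ X out≤k)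
    where
    covered : H ⊆G skeleton
    covered u v Huv with skeleton u v in eq
    ... | true = refl
    -- An edge outside `skeleton` would make it a proper subgraph that preserves all connectivities
    -- up to `k`.
    ... | false = ⊥-elim (critical skeleton skeleton⊆ (u , v , Huv , eq)
                    (preserver skeleton⊆ λ s t j → skeleton-lam _ s t j (n<1+n _)))

-- Counting the edges with small cuts

module _ {k K ℓ : ℕ} (1≤ℓ : 1 ≤ ℓ) (k≤ℓ : k ≤ ℓ) (k+K≤ℓ² : k + K ≤ ℓ * ℓ) where

  -- Otherwise the tails inside X are too few to serve the heads inside X, and more than K edges enter X.
  many-tails-inside : ∀ {n} (G : Graph n) P Q X u →
    (∀ x → P x ≡ true → 2 * ℓ ≤ deg G Q x) → (∀ y → Q y ≡ true → 2 * ℓ ≤ deg (G ᵀ) P y) →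
    P u ≡ true → X u ≡ true → e G X (∁ X) ≤ k → e G (∁ X) X ≤ K → ℓ ≤ size (P ∩ X)
  many-tails-inside G P Q X u degP degQ Pu Xu out≤k in≤K with ℓ ≤? size (P ∩ X)
  ... | yes ℓ≤ = ℓ≤
  ... | no ℓ≰ = ⊥-elim (<-irrefl refl (begin-strict
    ℓ * ℓ                            <⟨ *-monoʳ-< ℓ {{>-nonZero 1≤ℓ}} (n<1+n ℓ) ⟩
    ℓ * suc ℓ                        ≤⟨ *-monoˡ-≤ (suc ℓ) many-heads ⟩
    size (Q ∩ X) * suc ℓ             ≤⟨ deg-lower⇒e-lower (G ᵀ) (Q ∩ X) (P ∖ X) (suc ℓ) rich ⟩
    e (G ᵀ) (Q ∩ X) (P ∖ X)          ≡⟨ e-ᵀ G (Q ∩ X) (P ∖ X) ⟩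
    e G (P ∖ X) (Q ∩ X)              ≤⟨ e-mono (λ a b p q g → proj₂ (∧-true p) , proj₂ (∧-true q) , g) ⟩
    e G (∁ X) X                      ≤⟨ in≤K ⟩
    K                                ≤⟨ m≤n+m K k ⟩
    k + K                            ≤⟨ k+K≤ℓ² ⟩
    ℓ * ℓ                            ∎))
    where
    open ≤-Reasoning
    2ℓ≡ : 2 * ℓ ≡ ℓ + ℓ
    2ℓ≡ = cong (ℓ +_) (+-identityʳ ℓ)
    -- Of the at least `2 * ℓ` heads of `u` in `Q`, at most `k ≤ ℓ` lie outside `X`, since their
    -- edges leave `X`.
    many-heads : ℓ ≤ size (Q ∩ X)
    many-heads = +-cancelʳ-≤ ℓ _ _ (begin
      ℓ + ℓ                              ≡⟨ 2ℓ≡ ⟨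
      2 * ℓ                              ≤⟨ degP u Pu ⟩
      deg G Q u                          ≡⟨ deg-split G Q X u ⟩
      deg G (Q ∩ X) u + deg G (Q ∖ X) u  ≤⟨ +-mono-≤ (deg≤size G (Q ∩ X) u) (deg≤e G X (Q ∖ X) u Xu) ⟩
      size (Q ∩ X) + e G X (Q ∖ X)       ≤⟨ +-monoʳ-≤ _ (e-mono (λ a b x q g → x , proj₂ (∧-true q) , g)) ⟩
      size (Q ∩ X) + e G X (∁ X)         ≤⟨ +-monoʳ-≤ _ (≤-trans out≤k k≤ℓ) ⟩
      size (Q ∩ X) + ℓ                   ∎)
    -- Strictly fewer than `ℓ` tails lie in `X`, which yields `suc ℓ` outside; this extra one makes
    -- the final chain strict.
    rich : ∀ y → (Q ∩ X) y ≡ true → suc ℓ ≤ deg (G ᵀ) (P ∖ X) y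
    rich y QXy = +-cancelˡ-≤ ℓ _ _ (begin
      ℓ + suc ℓ                                       ≡⟨ +-suc ℓ ℓ ⟩
      suc (ℓ + ℓ)                                     ≡⟨ cong suc 2ℓ≡ ⟨
      suc (2 * ℓ)                                     ≤⟨ s≤s (degQ y (proj₁ (∧-true QXy))) ⟩
      suc (deg (G ᵀ) P y)                             ≡⟨ cong suc (deg-split (G ᵀ) P X y) ⟩
      suc (deg (G ᵀ) (P ∩ X) y) + deg (G ᵀ) (P ∖ X) y ≤⟨ +-monoˡ-≤ _ (≤-trans (s≤s (deg≤size (G ᵀ) (P ∩ X) y)) (≰⇒> ℓ≰)) ⟩
      ℓ + deg (G ᵀ) (P ∖ X) y                         ∎)

  module _ {n} (G : Graph n)
    (edge-cut : ∀ u v → G u v ≡ true → Σ[ X ∈ VSet n ] X u ≡ true × X v ≡ false × e G X (∁ X) ≤ k)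
    (in-bound : ∀ X → e G X (∁ X) ≤ k → e G (∁ X) X ≤ K) where

    private
      -- The summand `ℓ * ℓ` is credit for splitting: the two parts bring it twice, the whole needs
      -- it once, and the surplus covers the at most `k + K ≤ ℓ * ℓ` edges between the parts.
      Bound : VSet n → VSet n → Set
      Bound P Q = e G P Q + ℓ * ℓ ≤ 3 * (ℓ * (size P + size Q))

      -- Discarding a vertex frees `3 * ℓ` on the right, more than the at most `2 * ℓ` edges lost on
      -- the left.
      bound-remove : ∀ {a d σ} → d ≤ 2 * ℓ → a + ℓ * ℓ ≤ 3 * (ℓ * σ) → a + d + ℓ * ℓ ≤ 3 * (ℓ * suc σ)
      bound-remove {a} {d} {σ} d≤ a≤ = begin
        a + d + ℓ * ℓ          ≡⟨ perm a d (ℓ * ℓ) ⟩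
        (a + ℓ * ℓ) + d        ≤⟨ +-mono-≤ a≤ d≤ ⟩
        3 * (ℓ * σ) + 2 * ℓ    ≤⟨ m≤m+n _ ℓ ⟩
        3 * (ℓ * σ) + 2 * ℓ + ℓ ≡⟨ collect ℓ σ ⟩
        3 * (ℓ * suc σ)        ∎
        where
        open ≤-Reasoning
        perm : ∀ a d x → a + d + x ≡ (a + x) + d
        perm = solve-∀
        collect : ∀ l s → 3 * (l * s) + 2 * l + l ≡ 3 * (l * suc s)
        collect = solve-∀

      bound-split : ∀ P Q X → e G X (∁ X) ≤ k → Bound (P ∩ X) (Q ∩ X) → Bound (P ∖ X) (Q ∖ X) → Bound P Q
      bound-split P Q X out≤k inside outside = begin
        e G P Q + ℓ * ℓ
          ≡⟨ cong (_+ ℓ * ℓ) (trans (e-split-tails G P Q X) (cong₂ _+_ (e-split-heads G P₁ Q X) (e-split-heads G P₂ Q X))) ⟩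
        (e G P₁ Q₁ + e G P₁ Q₂) + (e G P₂ Q₁ + e G P₂ Q₂) + ℓ * ℓ
          ≤⟨ +-monoˡ-≤ (ℓ * ℓ) (+-mono-≤ (+-monoʳ-≤ (e G P₁ Q₁) forward) (+-monoˡ-≤ (e G P₂ Q₂) backward)) ⟩
        (e G P₁ Q₁ + k) + (K + e G P₂ Q₂) + ℓ * ℓ
          ≡⟨ perm (e G P₁ Q₁) (e G P₂ Q₂) k K (ℓ * ℓ) ⟩
        (k + K) + (e G P₁ Q₁ + (e G P₂ Q₂ + ℓ * ℓ))
          ≤⟨ +-monoˡ-≤ _ k+K≤ℓ² ⟩
        ℓ * ℓ + (e G P₁ Q₁ + (e G P₂ Q₂ + ℓ * ℓ))
          ≡⟨ perm₂ (ℓ * ℓ) (e G P₁ Q₁) _ ⟩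
        (e G P₁ Q₁ + ℓ * ℓ) + (e G P₂ Q₂ + ℓ * ℓ)
          ≤⟨ +-mono-≤ inside outside ⟩
        3 * (ℓ * (size P₁ + size Q₁)) + 3 * (ℓ * (size P₂ + size Q₂))
          ≡⟨ collect ℓ (size P₁) (size Q₁) (size P₂) (size Q₂) ⟩
        3 * (ℓ * ((size P₁ + size P₂) + (size Q₁ + size Q₂)))
          ≡⟨ cong₂ (λ a b → 3 * (ℓ * (a + b))) (size-split P X) (size-split Q X) ⟨
        3 * (ℓ * (size P + size Q)) ∎
        where
        open ≤-Reasoning
        P₁ = P ∩ X
        P₂ = P ∖ X
        Q₁ = Q ∩ X
        Q₂ = Q ∖ X
        forward : e G P₁ Q₂ ≤ k
        forward = ≤-trans (e-mono λ a b p q g → proj₂ (∧-true p) , proj₂ (∧-true q) , g) out≤k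
        backward : e G P₂ Q₁ ≤ K
        backward = ≤-trans (e-mono λ a b p q g → proj₂ (∧-true p) , proj₂ (∧-true q) , g) (in-bound X out≤k)
        perm : ∀ a d k K x → (a + k) + (K + d) + x ≡ (k + K) + (a + (d + x))
        perm = solve-∀
        perm₂ : ∀ x a y → x + (a + y) ≡ (a + x) + y
        perm₂ = solve-∀
        collect : ∀ l a b c d → 3 * (l * (a + b)) + 3 * (l * (c + d)) ≡ 3 * (l * ((a + c) + (b + d)))
        collect = solve-∀

    -- Induction on a bound `N` for the total size, keeping that size at least `ℓ`: vertices are
    -- discarded only while it exceeds `ℓ`, and a split leaves at least `ℓ` on each side. As `ℓ` is
    -- positive, both sides of a split are smaller than the whole.
    edge-bound : ∀ N P Q → size P + size Q ≤ N → ℓ ≤ size P + size Q → e G P Q + ℓ * ℓ ≤ 3 * (ℓ * (size P + size Q))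
    edge-bound zero P Q σ≤0 ℓ≤σ = ⊥-elim (<⇒≱ 1≤ℓ (≤-trans ℓ≤σ σ≤0))
    edge-bound (suc N) P Q σ≤N ℓ≤σ with size P + size Q ≤? ℓ
    -- The total size is exactly `ℓ` here, and the trivial bound by the product of the sizes is at
    -- most `ℓ * ℓ`.
    ... | yes σ≤ℓ = begin
      e G P Q + ℓ * ℓ              ≤⟨ +-monoˡ-≤ (ℓ * ℓ) (e≤size*size G P Q) ⟩
      size P * size Q + ℓ * ℓ      ≤⟨ +-monoˡ-≤ (ℓ * ℓ) (*-mono-≤ (≤-trans (m≤m+n (size P) (size Q)) σ≤ℓ) (≤-trans (m≤n+m (size Q) (size P)) σ≤ℓ)) ⟩
      ℓ * ℓ + ℓ * ℓ                ≤⟨ +-monoʳ-≤ (ℓ * ℓ) (m≤m+n _ _) ⟩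
      3 * (ℓ * ℓ)                  ≤⟨ *-monoʳ-≤ 3 (*-monoʳ-≤ ℓ ℓ≤σ) ⟩
      3 * (ℓ * (size P + size Q))  ∎
      where open ≤-Reasoning
    ... | no σ≰ℓ with any? (λ u → (P u Bool.≟ true) ×-dec (deg G Q u <? 2 * ℓ))
    ... | yes (u , Pu , deg<) =
      subst (λ x → x + ℓ * ℓ ≤ 3 * (ℓ * (size P + size Q))) (sym (e-delete-tail G P Q u Pu))
        (subst (λ x → e G (delete u P) Q + deg G Q u + ℓ * ℓ ≤ 3 * (ℓ * x)) (sym σ≡)
          (bound-remove {a = e G (delete u P) Q} (<⇒≤ deg<)
            (edge-bound N (delete u P) Q (s≤s⁻¹ (subst (_≤ suc N) σ≡ σ≤N)) (s≤s⁻¹ (subst (suc ℓ ≤_) σ≡ (≰⇒> σ≰ℓ))))))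
      where
      σ≡ : size P + size Q ≡ suc (size (delete u P) + size Q)
      σ≡ = cong (_+ size Q) (size-delete u P Pu)
    ... | no degP≥ with any? (λ v → (Q v Bool.≟ true) ×-dec (deg (G ᵀ) P v <? 2 * ℓ))
    ... | yes (v , Qv , deg<) =
      subst (λ x → x + ℓ * ℓ ≤ 3 * (ℓ * (size P + size Q))) (sym e≡)
        (subst (λ x → e G P (delete v Q) + deg (G ᵀ) P v + ℓ * ℓ ≤ 3 * (ℓ * x)) (sym σ≡)
          (bound-remove {a = e G P (delete v Q)} (<⇒≤ deg<)
            (edge-bound N P (delete v Q) (s≤s⁻¹ (subst (_≤ suc N) σ≡ σ≤N)) (s≤s⁻¹ (subst (suc ℓ ≤_) σ≡ (≰⇒> σ≰ℓ))))))
      where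
      σ≡ : size P + size Q ≡ suc (size P + size (delete v Q))
      σ≡ = trans (cong (size P +_) (size-delete v Q Qv)) (+-suc _ _)
      e≡ : e G P Q ≡ e G P (delete v Q) + deg (G ᵀ) P v
      e≡ = trans (sym (e-ᵀ G Q P)) (trans (e-delete-tail (G ᵀ) Q P v Qv) (cong (_+ deg (G ᵀ) P v) (e-ᵀ G (delete v Q) P)))
    ... | no degQ≥ with any? (λ u → any? (λ v → (P u Bool.≟ true) ×-dec (Q v Bool.≟ true) ×-dec (G u v Bool.≟ true)))
    ... | no none = begin
      e G P Q + ℓ * ℓ              ≡⟨ cong (_+ ℓ * ℓ) (e-empty G P Q (λ u v p q g → none (u , v , p , q , g))) ⟩
      ℓ * ℓ                        ≤⟨ m≤m+n _ _ ⟩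
      3 * (ℓ * ℓ)                  ≤⟨ *-monoʳ-≤ 3 (*-monoʳ-≤ ℓ ℓ≤σ) ⟩
      3 * (ℓ * (size P + size Q))  ∎
      where open ≤-Reasoning
    ... | yes (u , v , Pu , Qv , Guv) with edge-cut u v Guv
    ... | X , Xu , Xv , out≤k =
      bound-split P Q X out≤k
        (edge-bound N (P ∩ X) (Q ∩ X) (smaller σ₂≥ℓ (trans σ≡ (+-comm σ₁ σ₂))) σ₁≥ℓ)
        (edge-bound N (P ∖ X) (Q ∖ X) (smaller σ₁≥ℓ σ≡) σ₂≥ℓ)
      where
      in≤K = in-bound X out≤k
      degP : ∀ x → P x ≡ true → 2 * ℓ ≤ deg G Q x
      degP x Px = ≮⇒≥ (λ d< → degP≥ (x , Px , d<))
      degQ : ∀ y → Q y ≡ true → 2 * ℓ ≤ deg (G ᵀ) P y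
      degQ y Qy = ≮⇒≥ (λ d< → degQ≥ (y , Qy , d<))
      σ₁ σ₂ : ℕ
      σ₁ = size (P ∩ X) + size (Q ∩ X)
      σ₂ = size (P ∖ X) + size (Q ∖ X)
      σ≡ : size P + size Q ≡ σ₁ + σ₂
      σ≡ = trans (cong₂ _+_ (size-split P X) (size-split Q X)) (perm (size (P ∩ X)) _ _ _)
        where
        perm : ∀ a b c d → (a + b) + (c + d) ≡ (a + c) + (b + d)
        perm = solve-∀
      σ₁≥ℓ : ℓ ≤ σ₁
      σ₁≥ℓ = ≤-trans (many-tails-inside G P Q X u degP degQ Pu Xu out≤k in≤K) (m≤m+n _ _)
      σ₂≥ℓ : ℓ ≤ σ₂
      -- Duality: reversing all edges exchanges tails with heads, and the edges leaving `∁ X` in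
      -- `G ᵀ` are those leaving `X` in `G`. The head `v` takes the role of `u`.
      σ₂≥ℓ = ≤-trans
        (many-tails-inside (G ᵀ) Q P (∁ X) v degQ degP Qv (cong not Xv)
          (≤-trans (≤-reflexive (e-ᵀ G _ _)) (≤-trans (e-mono λ a b x y g → trans (sym (Bool.not-involutive _)) x , y , g) out≤k))
          (≤-trans (≤-reflexive (e-ᵀ G _ _)) (≤-trans (e-mono λ a b x y g → x , trans (sym (Bool.not-involutive _)) y , g) in≤K)))
        (m≤n+m _ _)
      smaller : ∀ {a b} → ℓ ≤ a → size P + size Q ≡ a + b → b ≤ N
      smaller {a} {b} ℓ≤a eq = s≤s⁻¹ (begin
        suc b             ≤⟨ +-monoˡ-≤ b (≤-trans 1≤ℓ ℓ≤a) ⟩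
        a + b             ≡⟨ eq ⟨
        size P + size Q   ≤⟨ σ≤N ⟩
        suc N             ∎)
        where open ≤-Reasoning

-- Choice of `ℓ` and the final estimate

-- An integer of the order of the square root. It is raised only when `ℓ * ℓ ≤ suc N`, and then the
-- increment `2 * ℓ + 1` of the square is absorbed by the factor 4, because `ℓ ≤ ℓ * ℓ`.
sqrt-upper : ∀ N → Σ[ ℓ ∈ ℕ ] 1 ≤ ℓ × suc N ≤ ℓ * ℓ × ℓ * ℓ ≤ 4 * suc N
sqrt-upper zero = 1 , ≤-refl , ≤-refl , s≤s z≤n
sqrt-upper (suc N) with sqrt-upper N
... | ℓ , 1≤ℓ , N≤ , ≤4N with suc (suc N) ≤? ℓ * ℓ
...   | yes ≤ℓ² = ℓ , 1≤ℓ , ≤ℓ² , ≤-trans ≤4N (*-monoʳ-≤ 4 (n≤1+n (suc N)))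
...   | no ≰ℓ² = suc ℓ , s≤s z≤n
        , (begin
          suc (suc N)             ≤⟨ s≤s N≤ ⟩
          suc (ℓ * ℓ)             ≤⟨ m≤m+n _ (2 * ℓ) ⟩
          suc (ℓ * ℓ) + 2 * ℓ     ≡⟨ square ℓ ⟩
          suc ℓ * suc ℓ           ∎)
        , (begin
          suc ℓ * suc ℓ           ≡⟨ square ℓ ⟨
          suc (ℓ * ℓ) + 2 * ℓ     ≤⟨ +-mono-≤ (s≤s ℓ²≤) (*-monoʳ-≤ 2 (≤-trans ℓ≤ℓ² ℓ²≤)) ⟩
          suc (suc N) + 2 * suc N ≤⟨ +-monoʳ-≤ (suc (suc N)) (≤-trans (*-monoʳ-≤ 2 (n≤1+n (suc N))) (m≤m+n _ (suc (suc N)))) ⟩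
          suc (suc N) + (2 * suc (suc N) + suc (suc N)) ≡⟨ four (suc (suc N)) ⟩
          4 * suc (suc N)         ∎)
  where
  open ≤-Reasoning
  ℓ²≤ : ℓ * ℓ ≤ suc N
  ℓ²≤ = s≤s⁻¹ (≰⇒> ≰ℓ²)
  ℓ≤ℓ² : ℓ ≤ ℓ * ℓ
  ℓ≤ℓ² = ≤-trans (≤-reflexive (sym (*-identityˡ ℓ))) (*-monoˡ-≤ ℓ 1≤ℓ)
  square : ∀ x → suc (x * x) + 2 * x ≡ suc x * suc x
  square = solve-∀
  four : ∀ x → x + (2 * x + x) ≡ 4 * x
  four = solve-∀

numEdges≤n² : ∀ {n} (G : Graph n) → numEdges G ≤ n * n
numEdges≤n² {n} G = ≤-trans (≤-reflexive (numEdges≡e G)) (≤-trans (e≤size*size G _ _) (≤-reflexive (cong₂ _*_ (size-⊤ n) (size-⊤ n))))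

critical-edges≤ : ∀ {n k ℓ} (H : Graph n) → IsCritical k H →
                  1 ≤ ℓ → k ≤ ℓ → k + n * (4 * k) ≤ ℓ * ℓ → numEdges H ≤ 6 * (ℓ * n)
critical-edges≤ {n} {k} {ℓ} H critical 1≤ℓ k≤ℓ large with ℓ ≤? n + n
-- The start `P = Q =` all vertices has total size `n + n`, which `edge-bound` requires to be at
-- least `ℓ`. For larger `ℓ` the trivial bound `n * n` is already below `ℓ * n`.
... | no ℓ≰2n = begin
  numEdges H    ≤⟨ numEdges≤n² H ⟩
  n * n         ≤⟨ *-monoˡ-≤ n (≤-trans (m≤m+n n n) (<⇒≤ (≰⇒> ℓ≰2n))) ⟩
  ℓ * n         ≤⟨ m≤m+n _ _ ⟩
  6 * (ℓ * n)   ∎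
  where open ≤-Reasoning
... | yes ℓ≤2n = begin
  numEdges H                ≡⟨ numEdges≡e H ⟩
  e H ⊤ ⊤                   ≤⟨ m≤m+n _ (ℓ * ℓ) ⟩
  e H ⊤ ⊤ + ℓ * ℓ           ≤⟨ edge-bound 1≤ℓ k≤ℓ large H (edge-in-small-cut critical) (critical-inn≤ k H critical)
                                 _ ⊤ ⊤ ≤-refl (subst (ℓ ≤_) (sym σ≡) ℓ≤2n) ⟩
  3 * (ℓ * (size ⊤ + size ⊤)) ≡⟨ cong (λ x → 3 * (ℓ * x)) σ≡ ⟩
  3 * (ℓ * (n + n))         ≡⟨ double ℓ n ⟩
  6 * (ℓ * n)               ∎
  where
  open ≤-Reasoning
  ⊤ : VSet n
  ⊤ _ = true
  σ≡ : size ⊤ + size ⊤ ≡ n + n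
  σ≡ = cong₂ _+_ (size-⊤ n) (size-⊤ n)
  double : ∀ l n → 3 * (l * (n + n)) ≡ 6 * (l * n)
  double = solve-∀

theorem5p3 : Σ ℕ (λ C → ∀ (k : ℕ) → 1 ≤ k → ∀ (n : ℕ) (H : Graph n) →
    IsCritical k H → numEdges H ^ 2 ≤ C * k * n ^ 3)
-- The constant is 36 * 4 * 5: the square of the 6 in `critical-edges≤`, the 4 of `sqrt-upper`, and
-- 5 from `k + n * (4 * k) ≤ 5 * (n * k)`.
theorem5p3 = 720 , bound
  where
  open ≤-Reasoning
  bound : ∀ k → 1 ≤ k → ∀ n (H : Graph n) → IsCritical k H → numEdges H ^ 2 ≤ 720 * k * n ^ 3
  -- The argument of `sqrt-upper` is one less than `k + n * (4 * k)`, since the lemma bounds its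
  -- successor.
  bound (suc k') _ n H critical with suc k' ≤? n | sqrt-upper (k' + n * (4 * suc k'))
  -- For `k > n` the trivial bound suffices: the square of `n * n` is `n * n ^ 3`.
  ... | no k≰n | _ = begin
    numEdges H ^ 2          ≤⟨ ^-monoˡ-≤ 2 (numEdges≤n² H) ⟩
    (n * n) ^ 2             ≡⟨ fourth n ⟩
    n * n ^ 3               ≤⟨ *-monoˡ-≤ (n ^ 3) (≤-trans (<⇒≤ (≰⇒> k≰n)) (m≤n*m (suc k') 720)) ⟩
    720 * suc k' * n ^ 3    ∎
    where
    fourth : ∀ n → (n * n) * ((n * n) * 1) ≡ n * (n * (n * (n * 1)))
    fourth = solve-∀
  ... | yes k≤n | ℓ , 1≤ℓ , large , ≤4N = begin
    numEdges H ^ 2                          ≤⟨ ^-monoˡ-≤ 2 (critical-edges≤ H critical 1≤ℓ k≤ℓ large) ⟩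
    (6 * (ℓ * n)) ^ 2                       ≡⟨ expand ℓ n ⟩
    36 * (n * n) * (ℓ * ℓ)                  ≤⟨ *-monoʳ-≤ (36 * (n * n)) ≤4N ⟩
    36 * (n * n) * (4 * (k + n * (4 * k)))  ≤⟨ *-monoʳ-≤ (36 * (n * n)) (*-monoʳ-≤ 4 (+-monoˡ-≤ (n * (4 * k)) k≤nk)) ⟩
    36 * (n * n) * (4 * (n * k + n * (4 * k))) ≡⟨ collect n k ⟩
    720 * k * n ^ 3                         ∎
    where
    k = suc k'
    k≤nk : k ≤ n * k
    k≤nk = ≤-trans (≤-reflexive (sym (*-identityˡ k))) (*-monoˡ-≤ k (≤-trans (s≤s z≤n) k≤n))
    -- Here `k ≤ n` enters: it puts `k * k` below `n * (4 * k)`, hence below `ℓ * ℓ`.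
    k≤ℓ : k ≤ ℓ
    k≤ℓ = ≮⇒≥ λ ℓ<k → <-irrefl refl (begin-strict
      ℓ * ℓ              <⟨ *-mono-< ℓ<k ℓ<k ⟩
      k * k              ≤⟨ *-mono-≤ k≤n (m≤n*m k 4) ⟩
      n * (4 * k)        ≤⟨ m≤n+m _ k ⟩
      k + n * (4 * k)    ≤⟨ large ⟩
      ℓ * ℓ              ∎)
    expand : ∀ l n → (6 * (l * n)) * ((6 * (l * n)) * 1) ≡ 36 * (n * n) * (l * l)
    expand = solve-∀
    collect : ∀ n k → 36 * (n * n) * (4 * (n * k + n * (4 * k))) ≡ 720 * k * (n * (n * (n * 1)))
    collect = solve-∀
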